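{- For every $\varepsilon>0$ there exists an instance $\mathcal{I}$ of the Strip Packing Problem such that $$\frac{h_{\text{BL}}^{\text{best}}(\mathcal{I})}{h_{\text{OPT}}(\mathcal{I})}\ \ge\ \frac43-\varepsilon ;$$ i.e., the approximation ratio of the bottom-left algorithm for the Strip Packing Problem cannot be better than $4/3-\varepsilon$, even if the rectangles are ordered in the best possible way.
   Context: Strip Packing Problem (SPP): given a strip width $W>0$ and rectangles $r_1,\dots,r_n$ with widths $w_i\le W$ and heights $h_i$, a packing assigns to each $r_i$ a lower-left corner $(x_i,y_i)$; it is feasible if $x_i\ge 0$, $x_i+w_i\le W$, $y_i\ge 0$ for all $i$, and the open rectangles $(x_i,x_i+w_i)\times(y_i,y_i+h_i)$ are pairwise disjoint. Rotations are not allowed. The height of a packing is $\max_i (y_i+h_i)$, and $h_{\text{OPT}}(\mathcal{I})$ is the minimum height of a feasible packing. Bottom-left algorithm: given an ordering $r_1,\dots,r_n$, place $r_1$ at $(0,0)$. Then, for $i=2,\dots,n$, place $r_i$ at a position $(x_i,y_i)$ such that the first $i$ rectangles form a feasible packing and $(y_i,x_i)$ is lexicographically minimal among all such positions. $h_{\text{BL}}^{\text{best}}(\mathcal{I})$ denotes the minimum, over all $n!$ orderings, of the height of the packing produced by the bottom-left algorithm.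
   Formalization: ε, the rectangle sizes and the coordinates of packings are rational; in particular the optimal height and the bottom-left positions are minima over packings with rational coordinates. -}

module Defs where

open import Data.Fin.Base as Fin using (Fin; zero; suc)
open import Data.Fin.Permutation using (Permutation′; _⟨$⟩ʳ_; _⟨$⟩ˡ_)
open import Data.Nat.Base using (ℕ; suc)
open import Data.Product.Base using (_×_; _,_; ∃-syntax)
open import Data.Product.Relation.Binary.Lex.Strict using (×-Lex)
open import Data.Rational.Base using (ℚ; 0ℚ; _+_; _≤_; _<_; _⊔_)
open import Data.Vec.Functional using (Vector; foldr; head; tail; updateAt)
open import Function.Base using (const)
open import Level using (Level; 0ℓ)
open import Relation.Binary.Core using (Rel)
open import Relation.Binary.PropositionalEquality.Core using (_≡_; _≢_)
open import Relation.Unary using (Pred; _∈_; _⊥_; U)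

-- All lengths and coordinates are rational. For rational sizes, the
-- bottom-left positions and the optimal height among real packings are
-- rational as well, so the heights defined here are the same as over ℝ; and
-- every real ε > 0 is bounded below by a positive rational one.

private
  variable
    a ℓ p : Level
    A : Set a

IsLeast : Rel A ℓ → Pred A p → Pred A _
IsLeast _≲_ P m = P m × (∀ x → P x → m ≲ x)

record Point : Set where
  constructor ⟨_,_⟩
  field
    x y : ℚ

open Point public

origin : Point
origin = ⟨ 0ℚ , 0ℚ ⟩

_≤BL_ : Rel Point 0ℓ
q ≤BL q′ = ×-Lex _≡_ _<_ _≤_ (y q , x q) (y q′ , x q′)

-- The number of rectangles is 1 + pred-n: the height of a packing is a
-- maximum over all rectangles, so there has to be at least one.
record Instance : Set where
  field
    pred-n : ℕ

  n : ℕ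
  n = suc pred-n

  field
    W   : ℚ
    W>0 : 0ℚ < W
    w h : Vector ℚ n
    w>0 : ∀ i → 0ℚ < w i
    w≤W : ∀ i → w i ≤ W
    h>0 : ∀ i → 0ℚ < h i

module _ (I : Instance) where
  open Instance I

  Packing : Set
  Packing = Vector Point n

  Ordering : Set
  Ordering = Permutation′ n

  InStrip : Fin n → Pred Point 0ℓ
  InStrip i q = 0ℚ ≤ x q × x q + w i ≤ W × 0ℚ ≤ y q

  OpenRect : Fin n → Point → Pred Point 0ℓ
  OpenRect i q z =
    (x q < x z × x z < x q + w i) × (y q < y z × y z < y q + h i)

  FeasibleOn : Pred (Fin n) 0ℓ → Pred Packing 0ℓ
  FeasibleOn S P =
    (∀ i → i ∈ S → InStrip i (P i)) ×
    (∀ i j → i ∈ S → j ∈ S → i ≢ j → OpenRect i (P i) ⊥ OpenRect j (P j))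

  Feasible : Pred Packing 0ℓ
  Feasible = FeasibleOn U

  height : Packing → ℚ
  height P = foldr _⊔_ (head tops) (tail tops)
    where
    tops : Vector ℚ n
    tops i = y (P i) + h i

  -- σ ⟨$⟩ʳ k is the rectangle placed in step k, and UpTo σ k consists of the
  -- rectangles placed in steps 0, …, k.
  UpTo : Ordering → Fin n → Pred (Fin n) 0ℓ
  UpTo σ k i = σ ⟨$⟩ˡ i Fin.≤ k

  record IsBottomLeft (σ : Ordering) (P : Packing) : Set where
    field
      first : P (σ ⟨$⟩ʳ zero) ≡ origin
      next  : ∀ (k : Fin pred-n) → let r = σ ⟨$⟩ʳ suc k in
              IsLeast _≤BL_
                (λ q → FeasibleOn (UpTo σ (suc k)) (updateAt P r (const q)))
                (P r)

  IsOptHeight : Pred ℚ 0ℓ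
  IsOptHeight = IsLeast _≤_ λ H → ∃[ P ] (Feasible P × height P ≡ H)

  IsBestBLHeight : Pred ℚ 0ℓ
  IsBestBLHeight =
    IsLeast _≤_ λ H → ∃[ σ ] ∃[ P ] (IsBottomLeft σ P × height P ≡ H)

{-# OPTIONS --safe #-}

-- In a strip of width 21, take two tall rectangles 4 × (2N + 1), a center 12 × N,
-- four flats 7 × N and a tower 1 × (3N + 1); the tower only makes the lower bound
-- on the optimum trivial. An optimal packing has height 3N + 1: one tall stands at
-- the bottom left with two flats to its right, the center and the other tall lie
-- on those flats, and the other two flats lie on the first tall and the center.
--
-- Below height 4N essentially this arrangement or a mirror image of it is forced.
-- The bottom-left rule misses it: if a flat precedes the bottom tall, the slack
-- 7 < 2 · 4 moves that tall too far left for the center to fit; if the tall comes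
-- first, its top 2N + 1 exceeds the top 2N of the center, so that the first upper
-- flat drops onto the center and leaves no room for the second one.
--
-- A bottom-left position has its coordinates among 0 and the right ends (tops) of
-- the rectangles already placed, and for N ≥ 10 the comparisons between them do
-- not depend on N, so the orderings can be explored by evaluation.
module Submission where

open import Defs
open import Algebra.Properties.CommutativeMonoid.Sum using (sum; sum-permute)
open import Data.Bool.Base using (Bool; true; false; T; _∧_; _∨_; if_then_else_)
open import Data.Bool.Properties using (T-∧; T-∨; T-≡)
open import Data.Bool.ListAction using (all; any)
open import Data.Fin.Base as Fin using (Fin; zero; suc; toℕ)
open import Data.Fin.Patterns using (4F; 7F)
import Data.Fin.Properties as Fin
open import Data.Fin.Permutation using (_⟨$⟩ʳ_; _⟨$⟩ˡ_; inverseʳ; inverseˡ)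
import Data.Fin.Permutation as Perm
open import Data.Integer.Base as ℤ using (+_; -[1+_]; +≤+; +<+)
import Data.Integer.Properties as ℤ
open import Data.List.Base using (List; []; _∷_; map; allFin; filter; foldr; cartesianProduct)
open import Data.List.Membership.Propositional using () renaming (_∈_ to _∈ₗ_)
open import Data.List.Membership.Propositional.Properties
  using (∈-filter⁺; ∈-allFin; ∈-cartesianProduct⁺)
open import Data.List.Relation.Unary.All as All using (All; []; _∷_)
import Data.List.Relation.Unary.All.Properties as All
open import Data.List.Relation.Unary.Any as Any using (Any; here; there)
import Data.List.Relation.Unary.Any.Properties as Any
open import Data.Nat.Base as ℕ using (ℕ; suc; _≡ᵇ_; _≤ᵇ_; _<ᵇ_)
import Data.Nat.Properties as ℕ
open import Data.Nat.Solver using (module +-*-Solver)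
open import Data.Product.Base using (_×_; _,_; proj₁; proj₂; ∃-syntax; Σ-syntax)
open import Data.Rational.Base
  using (ℚ; mkℚ; ↥_; ↧ₙ_; 0ℚ; _/_; 1/_; -_; _÷_; _+_; _-_; _≤_; _<_; _⊔_; NonZero; *≤*; *<*; toℚᵘ)
open import Data.Rational.Literals using (fromℤ)
import Data.Rational.Properties as ℚ
import Data.Rational.Unnormalised.Base as ℚᵘ
import Data.Rational.Unnormalised.Properties as ℚᵘ
open import Data.Sum.Base as Sum using (_⊎_; inj₁; inj₂; [_,_])
open import Data.Unit.Base using (tt)
open import Data.Vec.Functional as Vector using (Vector; updateAt)
open import Data.Vec.Functional.Properties using (updateAt-updates; updateAt-minimal; updateAt-id-local)
open import Function.Base using (_∘_; id; const)
open import Function.Bundles using (Equivalence)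
open import Relation.Binary.Definitions using (tri<; tri≈; tri>)
open import Relation.Binary.PropositionalEquality
  using (_≡_; _≢_; refl; sym; trans; cong; cong₂; subst; subst₂)
open import Relation.Nullary using (¬_; yes; no; contradiction)
open import Relation.Unary using (Pred; _∈_; _∉_; _⊥_; _⊆_; ∅)
open import Level using (0ℓ)

-- Boolean checks and the order on the rationals

private
  T-∧⁻ : ∀ {a b} → T (a ∧ b) → T a × T b
  T-∧⁻ = Equivalence.to T-∧

  T-∨⁻ : ∀ {a b} → T (a ∨ b) → T a ⊎ T b
  T-∨⁻ = Equivalence.to T-∨

all-lookup : ∀ {A : Set} (p : A → Bool) {xs} → T (all p xs) → ∀ {z} → z ∈ₗ xs → T (p z)
all-lookup p {xs} t = All.lookup (All.all⁺ p xs t)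

<⇒≱ : ∀ {p q} → p < q → ¬ q ≤ p
<⇒≱ p<q q≤p = ℚ.<-irrefl refl (ℚ.<-≤-trans p<q q≤p)

-- Rectangles in the plane: separation and overlap

record Rect : Set where
  constructor rect
  field
    corner        : Point
    width′ height′ : ℚ

  left right bottom top : ℚ
  left   = x corner
  right  = x corner + width′
  bottom = y corner
  top    = y corner + height′

open Rect

Interior : Rect → Pred Point 0ℓ
Interior R z = (left R < x z × x z < right R) × (bottom R < y z × y z < top R)

NonDegenerate : Rect → Set
NonDegenerate R = left R < right R × bottom R < top R

Apart Overlap : Rect → Rect → Set
Apart R S =
  (right R ≤ left S ⊎ right S ≤ left R) ⊎ (top R ≤ bottom S ⊎ top S ≤ bottom R)
Overlap R S =
  (left S < right R × left R < right S) × (bottom S < top R × bottom R < top S)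

Apart-sym : ∀ {R S} → Apart R S → Apart S R
Apart-sym = Sum.map Sum.swap Sum.swap

Apart⇒¬Overlap : ∀ {R S} → Apart R S → ¬ Overlap R S
Apart⇒¬Overlap (inj₁ (inj₁ p)) ((q , _) , _) = <⇒≱ q p
Apart⇒¬Overlap (inj₁ (inj₂ p)) ((_ , q) , _) = <⇒≱ q p
Apart⇒¬Overlap (inj₂ (inj₁ p)) (_ , (q , _)) = <⇒≱ q p
Apart⇒¬Overlap (inj₂ (inj₂ p)) (_ , (_ , q)) = <⇒≱ q p

Apart⇒⊥ : ∀ {R S} → Apart R S → Interior R ⊥ Interior S
Apart⇒⊥ {R} {S} a (((p₁ , p₂) , (p₃ , p₄)) , ((q₁ , q₂) , (q₃ , q₄))) =
  Apart⇒¬Overlap {R} {S} a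
    ((ℚ.<-trans q₁ p₂ , ℚ.<-trans p₁ q₂) , (ℚ.<-trans q₃ p₄ , ℚ.<-trans p₃ q₄))

-- The larger left end lies below the smaller right end, and density of the rationals supplies a
-- point between them; the four cases choose these two ends.
interval-overlap : ∀ {a b c d} → a < b → c < d → c < b → a < d →
                   ∃[ m ] ((a < m × m < b) × (c < m × m < d))
interval-overlap {a} {b} {c} {d} a<b c<d c<b a<d with ℚ.≤-total a c | ℚ.≤-total b d
... | inj₁ a≤c | inj₁ b≤d = let m , p , q = ℚ.<-dense c<b in
  m , (ℚ.≤-<-trans a≤c p , q) , (p , ℚ.<-≤-trans q b≤d)
... | inj₁ a≤c | inj₂ d≤b = let m , p , q = ℚ.<-dense c<d in
  m , (ℚ.≤-<-trans a≤c p , ℚ.<-≤-trans q d≤b) , (p , q)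
... | inj₂ c≤a | inj₁ b≤d = let m , p , q = ℚ.<-dense a<b in
  m , (p , q) , (ℚ.≤-<-trans c≤a p , ℚ.<-≤-trans q b≤d)
... | inj₂ c≤a | inj₂ d≤b = let m , p , q = ℚ.<-dense a<d in
  m , (p , ℚ.<-≤-trans q d≤b) , (ℚ.≤-<-trans c≤a p , q)

-- If all four separations fail, both pairs of projections overlap, and a common point in each
-- coordinate gives a common interior point.
⊥⇒Apart : ∀ {R S} → NonDegenerate R → NonDegenerate S →
          Interior R ⊥ Interior S → Apart R S
⊥⇒Apart {R} {S} (wR , hR) (wS , hS) disjoint
  with right R ℚ.≤? left S | right S ℚ.≤? left R | top R ℚ.≤? bottom S | top S ℚ.≤? bottom R
... | yes p | _     | _     | _     = inj₁ (inj₁ p)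
... | _     | yes p | _     | _     = inj₁ (inj₂ p)
... | _     | _     | yes p | _     = inj₂ (inj₁ p)
... | _     | _     | _     | yes p = inj₂ (inj₂ p)
... | no ¬a | no ¬b | no ¬c | no ¬d =
  let mx , px , qx = interval-overlap wR wS (ℚ.≰⇒> ¬a) (ℚ.≰⇒> ¬b)
      my , py , qy = interval-overlap hR hS (ℚ.≰⇒> ¬c) (ℚ.≰⇒> ¬d)
  in contradiction {A = Interior R ⟨ mx , my ⟩ × Interior S ⟨ mx , my ⟩}
       ((px , py) , (qx , qy)) disjoint

-- The bottom-left order and pushing a coordinate down

≤BL-antisym : ∀ {p q} → p ≤BL q → q ≤BL p → p ≡ q
≤BL-antisym (inj₁ a) (inj₁ b) = contradiction b (ℚ.<-asym a)
≤BL-antisym (inj₁ a) (inj₂ (e , _)) = contradiction a (ℚ.<-irrefl (sym e))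
≤BL-antisym (inj₂ (e , _)) (inj₁ a) = contradiction a (ℚ.<-irrefl (sym e))
≤BL-antisym (inj₂ (e , a)) (inj₂ (_ , b)) = cong₂ ⟨_,_⟩ (ℚ.≤-antisym a b) e

-- Extends minimality from finitely many candidates `q` to every position `r` that can be slid left
-- and down onto one of them.
≤BL-slide : ∀ {p q r} → p ≤BL q → x q ≤ x r → y q ≤ y r → p ≤BL r
≤BL-slide {q = q} {r} (inj₁ a) _ b = inj₁ (ℚ.<-≤-trans a b)
≤BL-slide {q = q} {r} (inj₂ (refl , a)) c b with ℚ.<-cmp (y q) (y r)
... | tri< d _ _ = inj₁ d
... | tri≈ _ e _ = inj₂ (e , ℚ.≤-trans a c)
... | tri> _ _ d = contradiction b (<⇒≱ d)

∈-insert : ∀ {A : Set} {z u t : A} {us} → t ∈ₗ z ∷ us → t ∈ₗ z ∷ u ∷ us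
∈-insert (here e)   = here e
∈-insert (there t∈) = there (there t∈)

-- The default `z` guarantees that some element qualifies; in the application it is the left or
-- bottom border of the strip.
greatest-below : ∀ {A : Set} (f : A → ℚ) z us {v} → f z ≤ v →
  ∃[ u ] (u ∈ₗ z ∷ us × f u ≤ v × All (λ u′ → f u′ ≤ v → f u′ ≤ f u) us)
greatest-below f z [] z≤v = z , here refl , z≤v , []
greatest-below f z (u ∷ us) {v} z≤v with f u ℚ.≤? v | greatest-below f z us z≤v
... | no u≰v | t , t∈ , t≤v , ub =
  t , ∈-insert t∈ , t≤v , ((λ u≤v → contradiction u≤v u≰v) ∷ ub)
... | yes u≤v | t , t∈ , t≤v , ub with ℚ.≤-total (f u) (f t)
...   | inj₁ u≤t = t , ∈-insert t∈ , t≤v , ((λ _ → u≤t) ∷ ub)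
...   | inj₂ t≤u =
  u , there (here refl) , u≤v , ((λ _ → ℚ.≤-refl) ∷ All.map (λ g w → ℚ.≤-trans (g w) t≤u) ub)

-- Heights, and adding one rectangle to a feasible packing

module _ (I : Instance) where
  open Instance I

  rectAt : Fin n → Point → Rect
  rectAt i q = rect q (w i) (h i)

  rectAt-nonDegenerate : ∀ i q → NonDegenerate (rectAt i q)
  rectAt-nonDegenerate i q = grow (x q) (w>0 i) , grow (y q) (h>0 i)
    where
    grow : ∀ a {b} → 0ℚ < b → a < a + b
    grow a {b} 0<b = subst (λ z → z < a + b) (ℚ.+-identityʳ a) (ℚ.+-monoʳ-< a 0<b)

  top≤height : ∀ P i → y (P i) + h i ≤ height I P
  top≤height P = go (λ i → y (P i) + h i)
    where
    below : ∀ {m} (a : ℚ) (t : Vector ℚ m) → a ≤ Vector.foldr _⊔_ a t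
    below {ℕ.zero} a t = ℚ.≤-refl
    below {suc m} a t = ℚ.≤-trans (below a (Vector.tail t)) (ℚ.p≤q⊔p (t zero) _)
    above : ∀ {m} (a : ℚ) (t : Vector ℚ m) i → t i ≤ Vector.foldr _⊔_ a t
    above a t zero = ℚ.p≤p⊔q (t zero) _
    above a t (suc i) = ℚ.≤-trans (above a (Vector.tail t) i) (ℚ.p≤q⊔p (t zero) _)
    go : ∀ (t : Vector ℚ n) i → t i ≤ Vector.foldr _⊔_ (t zero) (Vector.tail t)
    go t zero = below (t zero) (Vector.tail t)
    go t (suc i) = above (t zero) (Vector.tail t) i

  height≤ : ∀ P {H} → (∀ i → y (P i) + h i ≤ H) → height I P ≤ H
  height≤ P {H} ub = lub (Vector.tail (λ i → y (P i) + h i)) (ub zero) (ub ∘ suc)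
    where
    lub : ∀ {m} {a : ℚ} (t : Vector ℚ m) → a ≤ H → (∀ i → t i ≤ H) → Vector.foldr _⊔_ a t ≤ H
    lub {ℕ.zero} t a≤ t≤ = a≤
    lub {suc m} t a≤ t≤ = ℚ.⊔-lub (t≤ zero) (lub (Vector.tail t) a≤ (t≤ ∘ suc))

  module _ {S S′ : Pred (Fin n) 0ℓ} {r : Fin n} (P : Packing I)
           (r∉S : r ∉ S) (r∈S′ : r ∈ S′) (S⊆S′ : S ⊆ S′)
           (S′⊆ : ∀ {i} → i ∈ S′ → i ∈ S ⊎ i ≡ r) where

    private
      moved : Point → Packing I
      moved q = updateAt P r (const q)

      at-r : ∀ q → moved q r ≡ q
      at-r q = updateAt-updates r P

      at-S : ∀ q {i} → i ∈ S → moved q i ≡ P i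
      at-S q {i} i∈S = updateAt-minimal i r P λ { refl → r∉S i∈S }

    feasible⇒free : ∀ {q} → FeasibleOn I S′ (moved q) →
      InStrip I r q × (∀ i → i ∈ S → Apart (rectAt r q) (rectAt i (P i)))
    feasible⇒free {q} (strip , disj) =
      subst (InStrip I r) (at-r q) (strip r r∈S′) ,
      λ i i∈S → ⊥⇒Apart (rectAt-nonDegenerate r q) (rectAt-nonDegenerate i (P i))
        (subst₂ (λ a b → OpenRect I r a ⊥ OpenRect I i b) (at-r q) (at-S q i∈S)
          (disj r i r∈S′ (S⊆S′ i∈S) λ { refl → r∉S i∈S }))

    -- Constraints among members of `S` do not involve `r`, so they are inherited from the feasible
    -- position `q₀`; only those on `r` have to be supplied for `q`.
    free⇒feasible : ∀ {q q₀} → FeasibleOn I S′ (moved q₀) → InStrip I r q →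
      (∀ i → i ∈ S → Apart (rectAt r q) (rectAt i (P i))) → FeasibleOn I S′ (moved q)
    free⇒feasible {q} {q₀} (strip₀ , disj₀) strip apart = strip′ , disj′
      where
      strip′ : ∀ i → i ∈ S′ → InStrip I i (moved q i)
      strip′ i i∈S′ with S′⊆ i∈S′
      ... | inj₁ i∈S = subst (InStrip I i) (trans (at-S q₀ i∈S) (sym (at-S q i∈S))) (strip₀ i i∈S′)
      ... | inj₂ refl = subst (InStrip I i) (sym (at-r q)) strip
      disj′ : ∀ i j → i ∈ S′ → j ∈ S′ → i ≢ j →
              OpenRect I i (moved q i) ⊥ OpenRect I j (moved q j)
      disj′ i j i∈S′ j∈S′ i≢j with S′⊆ i∈S′ | S′⊆ j∈S′
      ... | inj₁ i∈S | inj₁ j∈S =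
        subst₂ (λ a b → OpenRect I i a ⊥ OpenRect I j b)
          (trans (at-S q₀ i∈S) (sym (at-S q i∈S))) (trans (at-S q₀ j∈S) (sym (at-S q j∈S)))
          (disj₀ i j i∈S′ j∈S′ i≢j)
      ... | inj₁ i∈S | inj₂ refl =
        subst₂ (λ a b → OpenRect I i a ⊥ OpenRect I j b) (sym (at-S q i∈S)) (sym (at-r q))
          (Apart⇒⊥ {rectAt i (P i)} {rectAt j q} (Apart-sym {rectAt j q} {rectAt i (P i)} (apart i i∈S)))
      ... | inj₂ refl | inj₁ j∈S =
        subst₂ (λ a b → OpenRect I i a ⊥ OpenRect I j b) (sym (at-r q)) (sym (at-S q j∈S))
          (Apart⇒⊥ {rectAt i q} {rectAt j (P j)} (apart j j∈S))
      ... | inj₂ refl | inj₂ refl = contradiction refl i≢j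

-- The symbolic model: kinds, lengths and placement tests

data Kind : Set where
  tall center flat tower : Kind

-- (a , b) stands for a N + b.
Len : Set
Len = ℕ × ℕ

Position Placed : Set
Position = ℕ × Len
Placed = Kind × Position

kinds : List Kind
kinds = tall ∷ center ∷ flat ∷ tower ∷ []

∈-kinds : ∀ κ → κ ∈ₗ kinds
∈-kinds tall   = here refl
∈-kinds center = there (here refl)
∈-kinds flat   = there (there (here refl))
∈-kinds tower  = there (there (there (here refl)))

-- Numeric rather than Boolean, so that sums of it are multiplicities and placing a rectangle is a
-- subtraction.
is : Kind → Kind → ℕ
is tall   tall   = 1
is center center = 1
is flat   flat   = 1
is tower  tower  = 1
is _      _      = 0

width : Kind → ℕ
width tall   = 4
width center = 12
width flat   = 7
width tower  = 1

tallness : Kind → Len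
tallness tall   = 2 , 1
tallness center = 1 , 0
tallness flat   = 1 , 0
tallness tower  = 3 , 1

stripWidth : ℕ
stripWidth = 21

width>0 : ∀ κ → 0 ℕ.< width κ
width>0 tall   = ℕ.z<s
width>0 center = ℕ.z<s
width>0 flat   = ℕ.z<s
width>0 tower  = ℕ.z<s

width≤stripWidth : ∀ κ → width κ ℕ.≤ stripWidth
width≤stripWidth tall   = ℕ.≤ᵇ⇒≤ _ _ tt
width≤stripWidth center = ℕ.≤ᵇ⇒≤ _ _ tt
width≤stripWidth flat   = ℕ.≤ᵇ⇒≤ _ _ tt
width≤stripWidth tower  = ℕ.≤ᵇ⇒≤ _ _ tt

infixl 6 _⊕_
_⊕_ : Len → Len → Len
(a , b) ⊕ (a′ , b′) = a ℕ.+ a′ , b ℕ.+ b′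

-- Sound for N ≥ 10, but incomplete when the lower-order part is 10 or more; the
-- checks below therefore never rely on a comparison being false.
infix 4 _<ˡ_ _≤ˡ_ _≤ᵖ_
_<ˡ_ _≤ˡ_ : Len → Len → Bool
(a , b) <ˡ (a′ , b′) = ((a <ᵇ a′) ∧ (b <ᵇ 10)) ∨ ((a ≡ᵇ a′) ∧ (b <ᵇ b′))
(a , b) ≤ˡ (a′ , b′) = ((a <ᵇ a′) ∧ (b <ᵇ 10)) ∨ ((a ≡ᵇ a′) ∧ (b ≤ᵇ b′))

_≤ᵖ_ : Position → Position → Bool
(x , y@(a , b)) ≤ᵖ (x′ , y′@(a′ , b′)) =
  (y <ˡ y′) ∨ (((a ≡ᵇ a′) ∧ (b ≡ᵇ b′)) ∧ (x ≤ᵇ x′))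

rightEnd : Placed → ℕ
rightEnd (κ , (x , _)) = x ℕ.+ width κ

topEnd : Placed → Len
topEnd (κ , (_ , y)) = y ⊕ tallness κ

apart overlaps : Placed → Placed → Bool
apart p@(_ , (x , y)) q@(_ , (x′ , y′)) =
  ((rightEnd p ≤ᵇ x′) ∨ (rightEnd q ≤ᵇ x)) ∨ ((topEnd p ≤ˡ y′) ∨ (topEnd q ≤ˡ y))
overlaps p@(_ , (x , y)) q@(_ , (x′ , y′)) =
  ((x′ <ᵇ rightEnd p) ∧ (x <ᵇ rightEnd q)) ∧ ((y′ <ˡ topEnd p) ∧ (y <ˡ topEnd q))

fits blocked : List Placed → Placed → Bool
fits bs p = (rightEnd p ≤ᵇ stripWidth) ∧ all (apart p) bs
blocked bs p = (stripWidth <ᵇ rightEnd p) ∨ any (overlaps p) bs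

candidates : List Placed → List Position
candidates bs = cartesianProduct (0 ∷ map rightEnd bs) ((0 , 0) ∷ map topEnd bs)

isBottomLeft : List Placed → Placed → Bool
isBottomLeft bs p@(κ , c) =
  fits bs p ∧ all (λ c′ → (c ≤ᵖ c′) ∨ blocked bs (κ , c′)) (candidates bs)

-- Only a guess, which isBottomLeft verifies; 9 N lies above all positions in use.
bottomLeft : Kind → List Placed → Position
bottomLeft κ bs =
  foldr (λ c best → if fits bs (κ , c) ∧ (c ≤ᵖ best) then c else best) (0 , (9 , 0)) (candidates bs)

-- Exhaustive search over the orderings of kinds

reaches4 : Placed → Bool
reaches4 p = 4 ≤ᵇ proj₁ (topEnd p)

-- Whether every continuation with the remaining rectangles produces one whose top
-- is at least 4 N. Branching on kinds suffices because rectangles of the same kind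
-- are interchangeable.
search : ℕ → List Placed → (Kind → ℕ) → Bool
continues : ℕ → List Placed → (Kind → ℕ) → Kind → Bool
branch : ℕ → List Placed → (Kind → ℕ) → Placed → Bool

search ℕ.zero  bs rem = false
search (suc f) bs rem = all (continues f bs rem) kinds

continues f bs rem κ = (rem κ ≡ᵇ 0) ∨ branch f bs rem (κ , bottomLeft κ bs)

branch f bs rem p@(κ , _) =
  isBottomLeft bs p ∧
  (reaches4 p ∨ search f (p ∷ bs) (λ κ′ → rem κ′ ℕ.∸ is κ′ κ))

-- A data type rather than a synonym for search … ≡ true, which the type checker
-- would try to evaluate on open terms.
data Succeeds (f : ℕ) (bs : List Placed) (rem : Kind → ℕ) : Set where
  succeeds : search f bs rem ≡ true → Succeeds f bs rem

-- Placing the last rectangle without any top at 4 N counts as failure of the search, so a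
-- successful search stops before its fuel runs out.
¬succeeds-zero : ∀ {bs rem} → ¬ Succeeds 0 bs rem
¬succeeds-zero (succeeds ())

succeeds-suc : ∀ {f bs rem} → Succeeds (suc f) bs rem → ∀ κ → let p = κ , bottomLeft κ bs in
  T (rem κ ≡ᵇ 0) ⊎
  (T (isBottomLeft bs p) ×
   (T (reaches4 p) ⊎ Succeeds f (p ∷ bs) (λ κ′ → rem κ′ ℕ.∸ is κ′ κ)))
succeeds-suc {f} {bs} {rem} (succeeds e) κ =
  let p = κ , bottomLeft κ bs in
  Sum.map₂ (λ b → let t₁ , t₂ = T-∧⁻ {isBottomLeft bs p} b in
                  t₁ , Sum.map₂ (succeeds ∘ Equivalence.to T-≡) (T-∨⁻ {reaches4 p} t₂))
    (T-∨⁻ {rem κ ≡ᵇ 0} (all-lookup (continues f bs rem) (Equivalence.from T-≡ e) (∈-kinds κ)))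

-- The eight rectangles, two packings of them, and multiplicities

kind : Fin 8 → Kind
kind = Vector.fromList (tall ∷ center ∷ flat ∷ tall ∷ tower ∷ flat ∷ flat ∷ flat ∷ [])

placedAt : Vector Position 8 → Fin 8 → Placed
placedAt c i = kind i , c i

-- The listing in `kind` is itself a best ordering: the bottom-left rule applied to it yields these
-- positions, with the last flat ending at 4 N.
blPositions : Vector Position 8
blPositions = Vector.fromList
  ( (0 , (0 , 0)) ∷ (4 , (0 , 0)) ∷ (4 , (1 , 0)) ∷ (16 , (0 , 0)) ∷ (20 , (0 , 0))
  ∷ (4 , (2 , 0)) ∷ (11 , (2 , 1)) ∷ (0 , (3 , 0)) ∷ [])

optPositions : Vector Position 8
optPositions = Vector.fromList
  ( (0 , (0 , 0)) ∷ (4 , (1 , 0)) ∷ (4 , (0 , 0)) ∷ (16 , (1 , 0)) ∷ (20 , (0 , 0))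
  ∷ (11 , (0 , 0)) ∷ (0 , (2 , 1)) ∷ (7 , (2 , 1)) ∷ [])

count : ∀ {m} → Kind → Vector Kind m → ℕ
count κ s = sum ℕ.+-0-commutativeMonoid (is κ ∘ s)

is-refl : ∀ κ → is κ κ ≡ 1
is-refl tall   = refl
is-refl center = refl
is-refl flat   = refl
is-refl tower  = refl

-- Ensures that the search has not skipped the kind which the ordering places next.
count-head : ∀ {f} (s : Vector Kind (suc f)) {k} → count (s zero) s ≡ k → ¬ T (k ≡ᵇ 0)
count-head s {ℕ.zero} e _ rewrite is-refl (s zero) with () ← e

count-tail : ∀ {f} κ (s : Vector Kind (suc f)) → count κ (s ∘ suc) ≡ count κ s ℕ.∸ is κ (s zero)
count-tail κ s = sym (ℕ.m+n∸m≡n (is κ (s zero)) (count κ (s ∘ suc)))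

firstBox : Kind → List Placed
firstBox κ = (κ , (0 , (0 , 0))) ∷ []

remaining : Kind → Kind → ℕ
remaining κ κ′ = count κ′ kind ℕ.∸ is κ′ κ

-- Each `refl` evaluates the whole search tree below one choice of the first rectangle, which lies
-- at the origin; the fuel 7 is the number of rectangles left.
search-succeeds : ∀ κ → Succeeds 7 (firstBox κ) (remaining κ)
search-succeeds tall   = succeeds refl
search-succeeds center = succeeds refl
search-succeeds flat   = succeeds refl
search-succeeds tower  = succeeds refl

-- Naturals as rationals, and the estimate of the ratio

ι : ℕ → ℚ
ι k = fromℤ (+ k)

ι-mono-≤ : ∀ {j k} → j ℕ.≤ k → ι j ≤ ι k
ι-mono-≤ {j} {k} j≤k =
  *≤* (subst₂ ℤ._≤_ (sym (ℤ.*-identityʳ (+ j))) (sym (ℤ.*-identityʳ (+ k))) (+≤+ j≤k))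

ι-mono-< : ∀ {j k} → j ℕ.< k → ι j < ι k
ι-mono-< {j} {k} j<k =
  *<* (subst₂ ℤ._<_ (sym (ℤ.*-identityʳ (+ j))) (sym (ℤ.*-identityʳ (+ k))) (+<+ j<k))

ι-+ : ∀ j k → ι j + ι k ≡ ι (j ℕ.+ k)
ι-+ j k = ℚ.toℚᵘ-injective (ℚᵘ.≃-trans (ℚ.toℚᵘ-homo-+ (ι j) (ι k))
  (ℚᵘ.*≡* (cong (ℤ._* + 1) (cong₂ ℤ._+_ (ℤ.*-identityʳ (+ j)) (ℤ.*-identityʳ (+ k))))))

-- The hypothesis on naturals is 4/3 ≤ a / (d + 1) + p / q with denominators cleared, where ε = p /
-- q.
fourThirds-bound : ∀ a d ε → let p = ℤ.∣ ↥ ε ∣ ; q = ↧ₙ ε in 0ℚ < ε →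
  4 ℕ.* (suc d ℕ.* q) ℕ.≤ (a ℕ.* q ℕ.+ p ℕ.* suc d) ℕ.* 3 →
  + 4 / 3 - ε ≤ ι a ÷ ι (suc d)
fourThirds-bound a d ε@(mkℚ -[1+ _ ] _ _) (*<* ())
fourThirds-bound a d ε@(mkℚ (+ p) q-1 _) _ bound =
  subst (+ 4 / 3 - ε ≤_)
    (trans (ℚ.+-assoc r ε (- ε)) (trans (cong (λ z → r + z) (ℚ.+-inverseʳ ε)) (ℚ.+-identityʳ r)))
    (ℚ.+-monoˡ-≤ (- ε) (ℚ.toℚᵘ-cancel-≤ (ℚᵘ.≤-respʳ-≃ (ℚᵘ.≃-sym r+ε) (ℚᵘ.*≤* cross))))
  where
  r = ι a ÷ ι (suc d)
  q = suc q-1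

  -- An unnormalised fraction, so that the comparison becomes a cross multiplication free of gcds.
  quotient = ℚᵘ.mkℚᵘ (+ a) d

  r+ε : toℚᵘ (r + ε) ℚᵘ.≃ quotient ℚᵘ.+ toℚᵘ ε
  r+ε = ℚᵘ.≃-trans (ℚ.toℚᵘ-homo-+ r ε) (ℚᵘ.+-congˡ (toℚᵘ ε)
    (ℚᵘ.≃-trans {k = quotient} (ℚ.toℚᵘ-homo-* (ι a) (1/ ι (suc d)))
      (ℚᵘ.*≡* (cong₂ ℤ._*_ (ℤ.*-identityʳ (+ a)) (cong (λ n → + suc n) (sym (ℕ.+-identityʳ d)))))))

  cross : + 4 ℤ.* + (suc d ℕ.* q) ℤ.≤ (+ a ℤ.* + q ℤ.+ + p ℤ.* + suc d) ℤ.* + 3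
  cross = subst₂ ℤ._≤_ (ℤ.pos-* 4 (suc d ℕ.* q))
    (trans (ℤ.pos-* (a ℕ.* q ℕ.+ p ℕ.* suc d) 3)
      (cong (ℤ._* + 3) (cong₂ ℤ._+_ (ℤ.pos-* a q) (ℤ.pos-* p (suc d)))))
    (+≤+ bound)

-- The gap 4/3 - 4n / (3n + 1) equals 4 / (3 (3n + 1)); it is at most 1 / q as soon as 4q ≤ 9n + 3.
cross-bound : ∀ n p q → 1 ℕ.≤ p → q ℕ.≤ n →
  4 ℕ.* ((3 ℕ.* n ℕ.+ 1) ℕ.* q) ℕ.≤ (4 ℕ.* n ℕ.* q ℕ.+ p ℕ.* (3 ℕ.* n ℕ.+ 1)) ℕ.* 3
cross-bound n p q 1≤p q≤n = begin
  4 ℕ.* (D ℕ.* q)                              ≡⟨ solve 2 (λ n q → con 4 :* ((con 3 :* n :+ con 1) :* q)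
                                                    := con 12 :* n :* q :+ con 4 :* q) refl n q ⟩
  12 ℕ.* n ℕ.* q ℕ.+ 4 ℕ.* q                   ≤⟨ ℕ.+-monoʳ-≤ (12 ℕ.* n ℕ.* q) (ℕ.*-mono-≤ {4} {9} (ℕ.m≤m+n 4 5) q≤n) ⟩
  12 ℕ.* n ℕ.* q ℕ.+ 9 ℕ.* n                   ≤⟨ ℕ.m≤m+n _ 3 ⟩
  12 ℕ.* n ℕ.* q ℕ.+ 9 ℕ.* n ℕ.+ 3             ≡⟨ solve 2 (λ n q → con 12 :* n :* q :+ con 9 :* n :+ con 3
                                                    := (con 4 :* n :* q :+ con 1 :* (con 3 :* n :+ con 1)) :* con 3) refl n q ⟩
  (4 ℕ.* n ℕ.* q ℕ.+ 1 ℕ.* D) ℕ.* 3            ≤⟨ ℕ.*-monoˡ-≤ 3 (ℕ.+-monoʳ-≤ (4 ℕ.* n ℕ.* q) (ℕ.*-monoˡ-≤ D 1≤p)) ⟩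
  (4 ℕ.* n ℕ.* q ℕ.+ p ℕ.* D) ℕ.* 3            ∎
  where
  open ℕ.≤-Reasoning
  open +-*-Solver
  D = 3 ℕ.* n ℕ.+ 1

0<⇒numerator : ∀ {ε} → 0ℚ < ε → 1 ℕ.≤ ℤ.∣ ↥ ε ∣
0<⇒numerator {mkℚ (+ suc _) _ _} _ = ℕ.s≤s ℕ.z≤n
0<⇒numerator {mkℚ (+ 0) _ _} (*<* (+<+ ()))
0<⇒numerator {mkℚ -[1+ _ ] _ _} (*<* ())

-- Soundness of the symbolic tests for N = 10 + m

module Scaled (m : ℕ) where

  N : ℕ
  N = 10 ℕ.+ m

  value : Len → ℕ
  value (a , b) = a ℕ.* N ℕ.+ b

  value-⊕ : ∀ u v → value u ℕ.+ value v ≡ value (u ⊕ v)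
  value-⊕ (a , b) (a′ , b′) =
    solve 5 (λ a b a′ b′ n → (a :* n :+ b) :+ (a′ :* n :+ b′) := (a :+ a′) :* n :+ (b :+ b′))
      refl a b a′ b′ N
    where open +-*-Solver

  ⟦_⟧ : Len → ℚ
  ⟦ u ⟧ = ι (value u)

  ⟦⟧-⊕ : ∀ u v → ⟦ u ⟧ + ⟦ v ⟧ ≡ ⟦ u ⊕ v ⟧
  ⟦⟧-⊕ u v = trans (ι-+ (value u) (value v)) (cong ι (value-⊕ u v))

  -- Since b < 10 ≤ N, the value a N + b stays below the next multiple of N.
  <-lexicographic : ∀ {a b a′ b′} → T ((a <ᵇ a′) ∧ (b <ᵇ 10)) → value (a , b) ℕ.< value (a′ , b′)
  <-lexicographic {a} {b} {a′} {b′} t = let a<a′ , b<10 = T-∧⁻ {a <ᵇ a′} t in begin-strict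
    a ℕ.* N ℕ.+ b    <⟨ ℕ.+-monoʳ-< (a ℕ.* N) (ℕ.<-≤-trans (ℕ.<ᵇ⇒< b 10 b<10) (ℕ.m≤m+n 10 m)) ⟩
    a ℕ.* N ℕ.+ N    ≡⟨ ℕ.+-comm (a ℕ.* N) N ⟩
    suc a ℕ.* N      ≤⟨ ℕ.*-monoˡ-≤ N (ℕ.<ᵇ⇒< a a′ a<a′) ⟩
    a′ ℕ.* N         ≤⟨ ℕ.m≤m+n (a′ ℕ.* N) b′ ⟩
    a′ ℕ.* N ℕ.+ b′  ∎
    where open ℕ.≤-Reasoning

  <ˡ-sound : ∀ u v → T (u <ˡ v) → ⟦ u ⟧ < ⟦ v ⟧
  <ˡ-sound (a , b) (a′ , b′) t with T-∨⁻ {(a <ᵇ a′) ∧ (b <ᵇ 10)} t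
  ... | inj₁ c = ι-mono-< (<-lexicographic {a} {b} {a′} {b′} c)
  ... | inj₂ c with T-∧⁻ {a ≡ᵇ a′} c
  ...   | p , q with refl ← ℕ.≡ᵇ⇒≡ a a′ p = ι-mono-< (ℕ.+-monoʳ-< (a ℕ.* N) (ℕ.<ᵇ⇒< b b′ q))

  ≤ˡ-sound : ∀ u v → T (u ≤ˡ v) → ⟦ u ⟧ ≤ ⟦ v ⟧
  ≤ˡ-sound (a , b) (a′ , b′) t with T-∨⁻ {(a <ᵇ a′) ∧ (b <ᵇ 10)} t
  ... | inj₁ c = ι-mono-≤ (ℕ.<⇒≤ (<-lexicographic {a} {b} {a′} {b′} c))
  ... | inj₂ c with T-∧⁻ {a ≡ᵇ a′} c
  ...   | p , q with refl ← ℕ.≡ᵇ⇒≡ a a′ p = ι-mono-≤ (ℕ.+-monoʳ-≤ (a ℕ.* N) (ℕ.≤ᵇ⇒≤ b b′ q))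

  point : Position → Point
  point (x , y) = ⟨ ι x , ⟦ y ⟧ ⟩

  ≤ᵖ-sound : ∀ p q → T (p ≤ᵖ q) → point p ≤BL point q
  ≤ᵖ-sound (x , y@(a , b)) (x′ , y′@(a′ , b′)) t with T-∨⁻ {y <ˡ y′} t
  ... | inj₁ c = inj₁ (<ˡ-sound y y′ c)
  ... | inj₂ c with T-∧⁻ {(a ≡ᵇ a′) ∧ (b ≡ᵇ b′)} c
  ...   | e , d with T-∧⁻ {a ≡ᵇ a′} e
  ...     | e₁ , e₂ with refl ← ℕ.≡ᵇ⇒≡ a a′ e₁ | refl ← ℕ.≡ᵇ⇒≡ b b′ e₂ =
    inj₂ (refl , ι-mono-≤ (ℕ.≤ᵇ⇒≤ x x′ d))

  rectOf : Kind → Point → Rect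
  rectOf κ q = rect q (ι (width κ)) ⟦ tallness κ ⟧

  box : Placed → Rect
  box (κ , c) = rectOf κ (point c)

  right-box : ∀ p → right (box p) ≡ ι (rightEnd p)
  right-box (κ , (x , _)) = ι-+ x (width κ)

  top-box : ∀ p → top (box p) ≡ ⟦ topEnd p ⟧
  top-box (κ , (_ , y)) = ⟦⟧-⊕ y (tallness κ)

  apart-sound : ∀ p q → T (apart p q) → Apart (box p) (box q)
  apart-sound p@(_ , (x , y)) q@(_ , (x′ , y′)) t =
    Sum.map
      (λ t → Sum.map (λ c → subst (_≤ ι x′) (sym (right-box p)) (ι-mono-≤ (ℕ.≤ᵇ⇒≤ _ _ c)))
                     (λ c → subst (_≤ ι x) (sym (right-box q)) (ι-mono-≤ (ℕ.≤ᵇ⇒≤ _ _ c)))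
                     (T-∨⁻ {rightEnd p ≤ᵇ x′} t))
      (λ t → Sum.map (λ c → subst (_≤ ⟦ y′ ⟧) (sym (top-box p)) (≤ˡ-sound (topEnd p) y′ c))
                     (λ c → subst (_≤ ⟦ y ⟧) (sym (top-box q)) (≤ˡ-sound (topEnd q) y c))
                     (T-∨⁻ {topEnd p ≤ˡ y′} t))
      (T-∨⁻ {(rightEnd p ≤ᵇ x′) ∨ (rightEnd q ≤ᵇ x)} t)

  overlaps-sound : ∀ p q → T (overlaps p q) → Overlap (box p) (box q)
  overlaps-sound p@(_ , (x , y)) q@(_ , (x′ , y′)) t =
    let tx , ty = T-∧⁻ {(x′ <ᵇ rightEnd p) ∧ (x <ᵇ rightEnd q)} t
        t₁ , t₂ = T-∧⁻ {x′ <ᵇ rightEnd p} tx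
        t₃ , t₄ = T-∧⁻ {y′ <ˡ topEnd p} ty
    in ( subst (ι x′ <_) (sym (right-box p)) (ι-mono-< (ℕ.<ᵇ⇒< _ _ t₁))
       , subst (ι x <_) (sym (right-box q)) (ι-mono-< (ℕ.<ᵇ⇒< _ _ t₂)))
     , ( subst (⟦ y′ ⟧ <_) (sym (top-box p)) (<ˡ-sound y′ (topEnd p) t₃)
       , subst (⟦ y ⟧ <_) (sym (top-box q)) (<ˡ-sound y (topEnd q) t₄))

  Free : List Placed → Kind → Pred Point 0ℓ
  Free bs κ q =
    (0ℚ ≤ x q × right (rectOf κ q) ≤ ι stripWidth × 0ℚ ≤ y q) ×
    All (λ b → Apart (rectOf κ q) (box b)) bs

  fits-sound : ∀ bs κ c → T (fits bs (κ , c)) → Free bs κ (point c)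
  fits-sound bs κ c t = let t₁ , t₂ = T-∧⁻ {rightEnd (κ , c) ≤ᵇ stripWidth} t in
    ( ι-mono-≤ ℕ.z≤n
    , subst (_≤ ι stripWidth) (sym (right-box (κ , c))) (ι-mono-≤ (ℕ.≤ᵇ⇒≤ _ _ t₁))
    , ι-mono-≤ ℕ.z≤n)
    , All.map (λ {b} → apart-sound (κ , c) b) (All.all⁺ (apart (κ , c)) bs t₂)

  blocked-sound : ∀ bs κ c → T (blocked bs (κ , c)) → ¬ Free bs κ (point c)
  blocked-sound bs κ c t ((_ , r≤W , _) , free) with T-∨⁻ {stripWidth <ᵇ rightEnd (κ , c)} t
  ... | inj₁ t₁ = <⇒≱ (ι-mono-< (ℕ.<ᵇ⇒< _ _ t₁)) (subst (_≤ ι stripWidth) (right-box (κ , c)) r≤W)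
  ... | inj₂ t₂ = All.lookupWith (λ {b} a o →
          Apart⇒¬Overlap {box (κ , c)} {box b} a (overlaps-sound (κ , c) b o))
          free (Any.any⁻ (overlaps (κ , c)) bs t₂)

  -- Each coordinate is lowered to the greatest candidate not above it. Boxes to the right or above
  -- stay separated because the move is left and down; boxes to the left or below do so because
  -- their right ends and tops are themselves candidates.
  slide : ∀ bs κ {q} → Free bs κ q →
    ∃[ c ] (c ∈ₗ candidates bs × Free bs κ (point c) × x (point c) ≤ x q × y (point c) ≤ y q)
  slide bs κ {q} ((0≤x , x≤W , 0≤y) , free) =
    let u , u∈ , u≤ , maxu = greatest-below ι 0 (map rightEnd bs) 0≤x
        v , v∈ , v≤ , maxv = greatest-below ⟦_⟧ (0 , 0) (map topEnd bs) 0≤y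
    in (u , v) , ∈-cartesianProduct⁺ u∈ v∈ ,
       ( (ι-mono-≤ ℕ.z≤n , ℚ.≤-trans (ℚ.+-monoˡ-≤ _ u≤) x≤W , ι-mono-≤ ℕ.z≤n)
       , All.zipWith (λ {b} → shift {b} {u} {v} u≤ v≤)
           (free , All.zip (All.map⁻ maxu , All.map⁻ maxv))) ,
       u≤ , v≤
    where
    shift : ∀ {b u v} → ι u ≤ x q → ⟦ v ⟧ ≤ y q →
            Apart (rectOf κ q) (box b) ×
            (ι (rightEnd b) ≤ x q → ι (rightEnd b) ≤ ι u) ×
            (⟦ topEnd b ⟧ ≤ y q → ⟦ topEnd b ⟧ ≤ ⟦ v ⟧) →
            Apart (rectOf κ (point (u , v))) (box b)
    shift u≤ v≤ (inj₁ (inj₁ a) , _) = inj₁ (inj₁ (ℚ.≤-trans (ℚ.+-monoˡ-≤ _ u≤) a))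
    shift u≤ v≤ (inj₂ (inj₁ a) , _) = inj₂ (inj₁ (ℚ.≤-trans (ℚ.+-monoˡ-≤ _ v≤) a))
    shift {b} {u} {v} _ _ (inj₁ (inj₂ a) , f , _) =
      inj₁ (inj₂ (subst (_≤ ι u) (sym (right-box b)) (f (subst (_≤ x q) (right-box b) a))))
    shift {b} {u} {v} _ _ (inj₂ (inj₂ a) , _ , g) =
      inj₂ (inj₂ (subst (_≤ ⟦ v ⟧) (sym (top-box b)) (g (subst (_≤ y q) (top-box b) a))))

  isBottomLeft-sound : ∀ bs κ c → T (isBottomLeft bs (κ , c)) →
                       IsLeast _≤BL_ (Free bs κ) (point c)
  isBottomLeft-sound bs κ c t =
    let t₁ , t₂ = T-∧⁻ {fits bs (κ , c)} t in
    fits-sound bs κ c t₁ , λ q free →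
      let c′ , c′∈ , free′ , x≤ , y≤ = slide bs κ free in
      ≤BL-slide {point c} {point c′} {q}
        ([ ≤ᵖ-sound c c′ , (λ b → contradiction free′ (blocked-sound bs κ c′ b)) ]
           (T-∨⁻ {c ≤ᵖ c′} (all-lookup (λ c′ → (c ≤ᵖ c′) ∨ blocked bs (κ , c′)) t₂ c′∈)))
        x≤ y≤

  -- The instance and its explicit packings

  tallness>0 : ∀ κ → 0 ℕ.< value (tallness κ)
  tallness>0 tall   = ℕ.z<s
  tallness>0 center = ℕ.z<s
  tallness>0 flat   = ℕ.z<s
  tallness>0 tower  = ℕ.z<s

  I : Instance
  I = record
    { pred-n = 7
    ; W = ι stripWidth
    ; W>0 = ι-mono-< ℕ.z<s
    ; w = λ i → ι (width (kind i))
    ; h = λ i → ⟦ tallness (kind i) ⟧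
    ; w>0 = λ i → ι-mono-< (width>0 (kind i))
    ; w≤W = λ i → ι-mono-≤ (width≤stripWidth (kind i))
    ; h>0 = λ i → ι-mono-< (tallness>0 (kind i))
    }

  packing : Vector Position 8 → Packing I
  packing c i = point (c i)

  compatible : Vector Position 8 → Fin 8 → Fin 8 → Bool
  compatible c i j = (toℕ i ≡ᵇ toℕ j) ∨ apart (placedAt c i) (placedAt c j)

  fitsAmong : Vector Position 8 → Fin 8 → Bool
  fitsAmong c i = (rightEnd (placedAt c i) ≤ᵇ stripWidth) ∧ all (compatible c i) (allFin 8)

  packing-feasible : ∀ c → T (all (fitsAmong c) (allFin 8)) → Feasible I (packing c)
  packing-feasible c t = (λ i _ → strip i) , (λ i j _ _ → disjoint i j)
    where
    at : ∀ i → T (rightEnd (placedAt c i) ≤ᵇ stripWidth) × T (all (compatible c i) (allFin 8))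
    at i = T-∧⁻ {rightEnd (placedAt c i) ≤ᵇ stripWidth} (all-lookup (fitsAmong c) t (∈-allFin i))

    strip : ∀ i → InStrip I i (packing c i)
    strip i = ι-mono-≤ ℕ.z≤n ,
      subst (_≤ ι stripWidth) (sym (right-box (placedAt c i))) (ι-mono-≤ (ℕ.≤ᵇ⇒≤ _ _ (proj₁ (at i)))) ,
      ι-mono-≤ ℕ.z≤n

    disjoint : ∀ i j → i ≢ j → OpenRect I i (packing c i) ⊥ OpenRect I j (packing c j)
    disjoint i j i≢j = Apart⇒⊥ {box (placedAt c i)} {box (placedAt c j)}
      ([ (λ e → contradiction (Fin.toℕ-injective (ℕ.≡ᵇ⇒≡ _ _ e)) i≢j)
       , apart-sound (placedAt c i) (placedAt c j) ]
         (T-∨⁻ {toℕ i ≡ᵇ toℕ j} (all-lookup (compatible c i) (proj₂ (at i)) (∈-allFin j))))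

  noHigherThan : Vector Position 8 → Fin 8 → Fin 8 → Bool
  noHigherThan c i j = topEnd (placedAt c j) ≤ˡ topEnd (placedAt c i)

  height-packing : ∀ c i → T (all (noHigherThan c i) (allFin 8)) →
                   height I (packing c) ≡ ⟦ topEnd (placedAt c i) ⟧
  height-packing c i t = ℚ.≤-antisym
    (height≤ I (packing c) λ j → subst (_≤ _) (sym (top-box (placedAt c j)))
      (≤ˡ-sound (topEnd (placedAt c j)) (topEnd (placedAt c i))
        (all-lookup (noHigherThan c i) t (∈-allFin j))))
    (subst (_≤ height I (packing c)) (top-box (placedAt c i)) (top≤height I (packing c) i))

  -- Every bottom-left run reaches 4 N

  IsBox : Packing I → Placed → Fin 8 → Set
  IsBox P b i = rectAt I i (P i) ≡ box b

  -- Indices are forgotten, which makes rectangles of one kind interchangeable. Both directions are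
  -- used: the first to get feasibility from `Free`, the second for the converse.
  Represents : Pred (Fin 8) 0ℓ → Packing I → List Placed → Set
  Represents S P bs =
    (∀ i → i ∈ S → Any (λ b → IsBox P b i) bs) × All (λ b → ∃[ i ] (i ∈ S × IsBox P b i)) bs

  represents-∷ : ∀ {S S′ : Pred (Fin 8) 0ℓ} {r P bs c} → Represents S P bs →
    r ∈ S′ → S ⊆ S′ → (∀ {i} → i ∈ S′ → i ∈ S ⊎ i ≡ r) → P r ≡ point c →
    Represents S′ P ((kind r , c) ∷ bs)
  represents-∷ {r = r} (cover , sound) r∈S′ S⊆S′ S′⊆ e =
    (λ i i∈S′ → [ there ∘ cover i , (λ { refl → here (cong (rectAt I r) e) }) ] (S′⊆ i∈S′)) ,
    ((r , r∈S′ , cong (rectAt I r) e) ∷ All.map (λ (i , i∈S , f) → i , S⊆S′ i∈S , f) sound)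

  module Step {S S′ : Pred (Fin 8) 0ℓ} {r : Fin 8} {P : Packing I} {bs : List Placed}
              (rep : Represents S P bs) (r∉S : r ∉ S) (r∈S′ : r ∈ S′) (S⊆S′ : S ⊆ S′)
              (S′⊆ : ∀ {i} → i ∈ S′ → i ∈ S ⊎ i ≡ r) where

    feasible⇒Free : ∀ {q} → FeasibleOn I S′ (updateAt P r (const q)) → Free bs (kind r) q
    feasible⇒Free {q} feasible =
      let strip , apart = feasible⇒free I P r∉S r∈S′ S⊆S′ S′⊆ feasible in
      strip , All.map (λ (i , i∈S , e) → subst (Apart (rectOf (kind r) q)) e (apart i i∈S)) (proj₂ rep)

    Free⇒feasible : ∀ {q q₀} → FeasibleOn I S′ (updateAt P r (const q₀)) →
                    Free bs (kind r) q → FeasibleOn I S′ (updateAt P r (const q))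
    Free⇒feasible {q} feasible₀ (strip , apart) =
      free⇒feasible I P r∉S r∈S′ S⊆S′ S′⊆ feasible₀ strip λ i i∈S →
        All.lookupWith (λ a e → subst (Apart (rectOf (kind r) q)) (sym e) a) apart (proj₁ rep i i∈S)

    -- The symbolic position and the one chosen by the algorithm are both least among the same
    -- positions, so antisymmetry identifies them.
    bottomLeft-unique : ∀ {c} → T (isBottomLeft bs (kind r , c)) →
      IsLeast _≤BL_ (λ q → FeasibleOn I S′ (updateAt P r (const q))) (P r) → P r ≡ point c
    bottomLeft-unique {c} t (feasible , least) =
      let free , least′ = isBottomLeft-sound bs (kind r) c t in
      ≤BL-antisym (least _ (Free⇒feasible feasible free)) (least′ _ (feasible⇒Free feasible))

  module LowerBound (σ : Ordering I) (P : Packing I) (bl : IsBottomLeft I σ P) where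
    open IsBottomLeft bl

    τ : Fin 8 → Fin 8
    τ = σ ⟨$⟩ʳ_

    rank : Fin 8 → ℕ
    rank i = toℕ (σ ⟨$⟩ˡ i)

    rank-τ : ∀ k → rank (τ k) ≡ toℕ k
    rank-τ k = cong toℕ (inverseˡ σ)

    rank-injective : ∀ i k → rank i ≡ toℕ k → i ≡ τ k
    rank-injective i k e =
      trans (sym (inverseʳ σ)) (cong τ (Fin.toℕ-injective e))

    reaches4-sound : ∀ r c → P r ≡ point c → T (reaches4 (kind r , c)) → ι (4 ℕ.* N) ≤ height I P
    reaches4-sound r c e t =
      let a , b = topEnd (kind r , c) in
      -- The constant part `b` of the top is simply dropped.
      ℚ.≤-trans (ι-mono-≤ (ℕ.≤-trans (ℕ.*-monoˡ-≤ N (ℕ.≤ᵇ⇒≤ 4 a t)) (ℕ.m≤m+n (a ℕ.* N) b)))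
        (subst (_≤ height I P)
          (trans (cong (λ q → y q + ⟦ tallness (kind r) ⟧) e) (top-box (kind r , c)))
          (top≤height I P r))

    -- Induction following the search along the given ordering: `bs` holds the outcome of steps 0 to
    -- k, `suc ∘ s` lists the steps to come, and `rem` counts their kinds.
    explore : ∀ f k bs rem (s : Fin f → Fin 7) → (∀ i → toℕ (s i) ≡ k ℕ.+ toℕ i) →
      Represents (λ i → rank i ℕ.≤ k) P bs →
      (∀ κ → count κ (kind ∘ τ ∘ suc ∘ s) ≡ rem κ) →
      Succeeds f bs rem → ι (4 ℕ.* N) ≤ height I P
    explore ℕ.zero k bs rem s index rep counts t = contradiction t ¬succeeds-zero
    explore (suc f) k bs rem s index rep counts t
      -- Replaces k by `toℕ (s zero)`, so that the set in `next (s zero)` is literally the ranks up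
      -- to `suc k`.
      with refl ← trans (index zero) (ℕ.+-identityʳ k) = conclude
      where
      r = τ (suc (s zero))
      κ = kind r
      c = bottomLeft κ bs
      κs = kind ∘ τ ∘ suc ∘ s

      r∉ : ¬ rank r ℕ.≤ k
      r∉ r≤ = ℕ.<⇒≱ (ℕ.n<1+n k) (subst (ℕ._≤ k) (rank-τ (suc (s zero))) r≤)

      r∈ : rank r ℕ.≤ suc k
      r∈ = ℕ.≤-reflexive (rank-τ (suc (s zero)))

      split : ∀ {i} → rank i ℕ.≤ suc k → rank i ℕ.≤ k ⊎ i ≡ r
      split {i} i≤ with ℕ.m≤n⇒m<n∨m≡n i≤
      ... | inj₁ i< = inj₁ (ℕ.s≤s⁻¹ i<)
      ... | inj₂ e  = inj₂ (rank-injective i (suc (s zero)) e)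

      open Step {P = P} rep r∉ r∈ ℕ.m≤n⇒m≤1+n split

      conclude : ι (4 ℕ.* N) ≤ height I P
      conclude with succeeds-suc t κ
      ... | inj₁ none = contradiction none (count-head κs (counts κ))
      ... | inj₂ (bottom-left , t′) =
        let e = bottomLeft-unique {c} bottom-left (next (s zero)) in
        [ reaches4-sound r c e
        , explore f (suc k) ((κ , c) ∷ bs) (λ κ′ → rem κ′ ℕ.∸ is κ′ κ) (s ∘ suc)
            (λ i → trans (index (suc i)) (ℕ.+-suc k (toℕ i)))
            (represents-∷ rep r∈ ℕ.m≤n⇒m≤1+n split e)
            (λ κ′ → trans (count-tail κ′ κs) (cong (ℕ._∸ is κ′ κ) (counts κ′))) ]
          t′

    lower-bound : ι (4 ℕ.* N) ≤ height I P
    lower-bound = explore 7 0 start rest id (λ _ → refl) represents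
      (λ κ → trans (count-tail κ (kind ∘ τ))
                   -- Reordering by σ leaves the multiplicities of the kinds unchanged.
                   (cong (ℕ._∸ is κ (kind r₀)) (sym (sum-permute ℕ.+-0-commutativeMonoid (is κ ∘ kind) σ))))
      (search-succeeds (kind r₀))
      where
      r₀ = τ zero
      start = firstBox (kind r₀)
      rest = remaining (kind r₀)
      represents : Represents (λ i → rank i ℕ.≤ 0) P start
      represents = represents-∷ {S = ∅} ((λ _ ()) , []) (ℕ.≤-reflexive (rank-τ zero)) (λ ())
        (λ {i} i≤0 → inj₂ (rank-injective i zero (ℕ.n≤0⇒n≡0 i≤0))) first

  -- A bottom-left run of height 4 N, and the optimum

  firstPlaced : ℕ → List Placed
  firstPlaced k = map (placedAt blPositions) (filter (λ i → toℕ i ℕ.≤? k) (allFin 8))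

  firstPlaced-represents : ∀ k → Represents (λ i → toℕ i ℕ.≤ k) (packing blPositions) (firstPlaced k)
  firstPlaced-represents k =
    (λ i i≤k → Any.map⁺ (Any.map (λ { refl → refl })
      (∈-filter⁺ (λ i → toℕ i ℕ.≤? k) (∈-allFin i) i≤k))) ,
    All.map⁺ (All.map (λ {i} i≤k → i , i≤k , refl) (All.all-filter (λ i → toℕ i ℕ.≤? k) (allFin 8)))

  blPacking-isBottomLeft : IsBottomLeft I Perm.id (packing blPositions)
  blPacking-isBottomLeft = record { first = refl ; next = next }
    where
    P = packing blPositions

    isNext : Fin 7 → Bool
    isNext k = isBottomLeft (firstPlaced (toℕ k)) (placedAt blPositions (suc k))

    all-next : T (all isNext (allFin 7))
    all-next = tt

    next : ∀ k → IsLeast _≤BL_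
      (λ q → FeasibleOn I (UpTo I Perm.id (suc k)) (updateAt P (suc k) (const q))) (P (suc k))
    next k = feasible , λ q → least q ∘ feasible⇒Free
      where
      split : ∀ {i : Fin 8} → toℕ i ℕ.≤ suc (toℕ k) → toℕ i ℕ.≤ toℕ k ⊎ i ≡ suc k
      split i≤ = Sum.map ℕ.s≤s⁻¹ Fin.toℕ-injective (ℕ.m≤n⇒m<n∨m≡n i≤)

      open Step {r = suc k} {P} (firstPlaced-represents (toℕ k))
        (ℕ.<⇒≱ (ℕ.n<1+n (toℕ k))) ℕ.≤-refl ℕ.m≤n⇒m≤1+n split

      least : ∀ q → Free (firstPlaced (toℕ k)) (kind (suc k)) q → P (suc k) ≤BL q
      least = proj₂ (isBottomLeft-sound (firstPlaced (toℕ k)) (kind (suc k)) (blPositions (suc k))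
                (all-lookup isNext all-next (∈-allFin k)))

      unmoved : ∀ i → P i ≡ updateAt P (suc k) (const (P (suc k))) i
      unmoved i = sym (updateAt-id-local (suc k) P refl i)

      feasible : FeasibleOn I (UpTo I Perm.id (suc k)) (updateAt P (suc k) (const (P (suc k))))
      -- The complete packing is feasible, hence so is every initial segment; overwriting a corner
      -- with its own value changes nothing.
      feasible = let strip , disjoint = packing-feasible blPositions tt in
        (λ i _ → subst (InStrip I i) (unmoved i) (strip i tt)) ,
        (λ i j _ _ i≢j → subst₂ (λ a b → OpenRect I i a ⊥ OpenRect I j b) (unmoved i) (unmoved j)
          (disjoint i j tt tt i≢j))

  bestBL : IsBestBLHeight I (ι (4 ℕ.* N))
  bestBL = (Perm.id , packing blPositions , blPacking-isBottomLeft ,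
            -- `7F` is the last flat, from 3 N to 4 N; its symbolic top is 4 N + 0.
            trans (height-packing blPositions 7F tt) (cong ι (ℕ.+-identityʳ _))) ,
    λ { _ (σ , P , bl , refl) → LowerBound.lower-bound σ P bl }

  opt : IsOptHeight I (ι (3 ℕ.* N ℕ.+ 1))
  opt = (packing optPositions , packing-feasible optPositions tt , height-packing optPositions 4F tt) ,
    -- `4F` is the tower: its bottom is at least 0, so its top alone gives the bound.
    λ { _ (P , (strip , _) , refl) → ℚ.≤-trans
          (subst (_≤ y (P 4F) + ⟦ tallness tower ⟧) (ℚ.+-identityˡ _)
            (ℚ.+-monoˡ-≤ ⟦ tallness tower ⟧ (proj₂ (proj₂ (strip 4F tt)))))
          (top≤height I P 4F) }

theorem4 : ∀ (ε : ℚ) → 0ℚ < ε →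
    ∃[ I ] ∃[ hBL ] ∃[ hOPT ]
    (IsBestBLHeight I hBL × IsOptHeight I hOPT ×
    Σ[ hOPT≢0 ∈ NonZero hOPT ]
    ((+ 4) / 3) - ε ≤ (hBL ÷ hOPT) {{hOPT≢0}})
theorem4 ε 0<ε =
  I , ι (4 ℕ.* N) , ι (3 ℕ.* N ℕ.+ 1) , bestBL , opt , _ ,
  fourThirds-bound (4 ℕ.* N) (ℕ.pred (3 ℕ.* N ℕ.+ 1)) ε 0<ε
    (cross-bound N ℤ.∣ ↥ ε ∣ (↧ₙ ε) (0<⇒numerator 0<ε) (ℕ.m≤n+m (↧ₙ ε) 10))
  -- With q the denominator of ε, N = 10 + q serves both the symbolic comparisons (N ≥ 10) and the
  -- ratio estimate (N ≥ q).
  where open Scaled (↧ₙ ε)
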